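{- Suppose that $\kappa$ is a measurable cardinal and $X$ is a locally $<\kappa$ Hausdorff space of size $\kappa$ such that every point in $X$ has a point-base (local base) of size $<\kappa$, and suppose that $X$ is $\sigma$-$D$ for some regular uncountable cardinal $\sigma<\kappa$. Then for every $\theta<\kappa$ there is $Y\subseteq X$ which is an open $\sigma$-$D$ subspace of $X$ and satisfies \[ \theta<|Y|<\kappa. \]
   Context: An open neighbourhood assignment (ONA) in a topological space $(X,\tau)$ is a function $U:X\to\tau$ such that $x\in U(x)$ for all $x\in X$. For $D\subseteq X$ write $\bigcup U``D=\bigcup\{U(x):x\in D\}$. An ONA $V$ is finer than $U$ iff $V(x)\subseteq U(x)$ for all $x\in X$. $X$ is locally $<\kappa$ iff there is an ONA $U$ of $X$ with $|U(x)|<\kappa$ for all $x\in X$. A subset $D\subseteq X$ is $U$-sticky iff $D$ is closed discrete in $X$ and for all $x\in X$, $U(x)\cap D\ne\emptyset$ implies $x\in\bigcup U``D$. For a regular cardinal $\sigma\ge\aleph_1$, $\mathbb{P}^\sigma_U(X)$ is the set of all $U$-sticky $D\subseteq X$ with $|D|<\sigma$, ordered by: $D\le D'$ iff $D\subseteq D'$ and $(D'\setminus D)\cap\bigcup U``D=\emptyset$. $X$ is $\sigma$-$D$ with respect to an ONA $U$ of $X$ iff for every $D\in\mathbb{P}^\sigma_U(X)$ and every $x\in X$ there is $D'\ge D$ in $\mathbb{P}^\sigma_U(X)$ with $x\in\bigcup U``D'$. $X$ is $\sigma$-$D$ iff for every ONA $U$ of $X$ there is a finer ONA $V$ of $X$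 such that $X$ is $\sigma$-$D$ with respect to $V$. -}

module Defs where

open import Data.Empty.Polymorphic using (⊥)
open import Data.Nat.Base using (ℕ)
open import Data.Product.Base using (Σ-syntax; ∃-syntax; _×_; _,_; proj₁; proj₂)
open import Data.Refinement using (Refinement; value)
open import Data.Sum.Base using (_⊎_)
open import Data.Unit.Polymorphic.Base using (⊤; tt)
open import Function.Base using (_∘_)
open import Function.Bundles using (_↣_; _⇔_)
open import Level using (_⊔_; suc)
open import Relation.Binary.PropositionalEquality using (_≢_)
open import Relation.Nullary.Negation using (¬_)
open import Relation.Unary
  using (Pred; _∈_; _∉_; _⊆_; _≐_; ∁; _∩_; _∖_; ⋃; ⋂; Empty; _≬_; _⊢_)

------------------------------------------------------------------------
-- Cardinality
--
-- A cardinal is represented by any type of that cardinality.  The notions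
-- below are meant to be read under excluded middle for all types; applied
-- to Σ-types, whose witnesses are not truncated, it also yields choice.

infix 4 _≺_

_≺_ : ∀ {a b} → Set a → Set b → Set (a ⊔ b)
A ≺ B = (A ↣ B) × ¬ (B ↣ A)

-- The elements of a subset, as a type.  Membership proofs are irrelevant
-- in a Refinement, so its elements are equal as soon as their values are,
-- and its cardinality is that of the subset.
∣_∣ : ∀ {a p} {A : Set a} → Pred A p → Set (a ⊔ p)
∣_∣ {A = A} P = Refinement A P

Uncountable : ∀ {ℓ} → Set ℓ → Set ℓ
Uncountable A = ℕ ≺ A

-- An infinite cardinal that is not a union of fewer than σ sets, each of
-- cardinality less than σ.
record Regular {ℓ} (σ : Set ℓ) : Set (suc ℓ) where
  field
    infinite   : ℕ ↣ σ
    notAUnion  : {I : Set ℓ} → I ≺ σ → (F : I → Pred σ ℓ) →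
                 (∀ i → ∣ F i ∣ ≺ σ) → ¬ (∀ s → s ∈ ⋃ I F)

------------------------------------------------------------------------
-- Measurable cardinals

record IsUltrafilter {ℓ ℓ′} {A : Set ℓ} (𝒰 : Pred (Pred A ℓ) ℓ′) : Set (suc ℓ ⊔ ℓ′) where
  field
    whole   : (λ _ → ⊤) ∈ 𝒰
    proper  : (λ _ → ⊥) ∉ 𝒰
    upward  : ∀ {S T} → S ⊆ T → S ∈ 𝒰 → T ∈ 𝒰
    meet    : ∀ {S T} → S ∈ 𝒰 → T ∈ 𝒰 → S ∩ T ∈ 𝒰
    ultra   : ∀ S → S ∈ 𝒰 ⊎ ∁ S ∈ 𝒰

Principal : ∀ {ℓ ℓ′} {A : Set ℓ} → Pred (Pred A ℓ) ℓ′ → Set (suc ℓ ⊔ ℓ′)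
Principal {ℓ} {A = A} 𝒰 = ∃[ a ] ((S : Pred A ℓ) → S ∈ 𝒰 ⇔ a ∈ S)

Complete : ∀ {ℓ ℓ′} (κ : Set ℓ) {A : Set ℓ} → Pred (Pred A ℓ) ℓ′ → Set (suc ℓ ⊔ ℓ′)
Complete {ℓ} κ {A} 𝒰 =
  {I : Set ℓ} → I ≺ κ → (F : I → Pred A ℓ) → (∀ i → F i ∈ 𝒰) → ⋂ I F ∈ 𝒰

record Measurable {ℓ} (κ : Set ℓ) : Set (suc (suc ℓ)) where
  field
    uncountable   : Uncountable κ
    𝒰             : Pred (Pred κ ℓ) (suc ℓ)
    isUltrafilter : IsUltrafilter 𝒰
    nonprincipal  : ¬ Principal 𝒰
    complete      : Complete κ 𝒰

------------------------------------------------------------------------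
-- Topological spaces

-- Being open lives in Set (suc ℓ) so that subspace topologies, whose open
-- sets are given by an existential over Pred X ℓ, stay at the same level.
-- Unions over index types in Set ℓ cover all collections of open sets:
-- classically X → Bool is a type in Set ℓ that indexes every subset of X.
record Topology {ℓ} (X : Set ℓ) : Set (suc (suc ℓ)) where
  field
    IsOpen   : Pred (Pred X ℓ) (suc ℓ)
    resp-≐   : ∀ {S T} → S ≐ T → IsOpen S → IsOpen T
    whole    : IsOpen (λ _ → ⊤)
    meet     : ∀ {S T} → IsOpen S → IsOpen T → IsOpen (S ∩ T)
    union    : {I : Set ℓ} (F : I → Pred X ℓ) → (∀ i → IsOpen (F i)) → IsOpen (⋃ I F)

open Topology public using (IsOpen)

subspace : ∀ {ℓ} {X : Set ℓ} → Topology X → (Y : Pred X ℓ) → Topology ∣ Y ∣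
subspace {ℓ} {X} τ Y = record
  { IsOpen = λ S → ∃[ O ] (IsOpen τ O × S ≐ value ⊢ O)
  ; resp-≐ = λ (S⊆T , T⊆S) (O , o , S⊆O , O⊆S) → O , o , S⊆O ∘ T⊆S , S⊆T ∘ O⊆S
  ; whole  = (λ _ → ⊤) , Topology.whole τ , (λ _ → tt) , (λ _ → tt)
  ; meet   = λ (O , o , S⊆O , O⊆S) (P , p , T⊆P , P⊆T) →
               O ∩ P , Topology.meet τ o p ,
               (λ (s , t) → S⊆O s , T⊆P t) , (λ (s , t) → O⊆S s , P⊆T t)
  ; union  = λ {I} F f →
               ⋃ I (proj₁ ∘ f) , Topology.union τ (proj₁ ∘ f) (proj₁ ∘ proj₂ ∘ f) ,
               (λ (i , s) → i , proj₁ (proj₂ (proj₂ (f i))) s) ,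
               (λ (i , s) → i , proj₂ (proj₂ (proj₂ (f i))) s)
  }

module _ {ℓ} {X : Set ℓ} (τ : Topology X) where

  IsClosed : Pred X ℓ → Set (suc ℓ)
  IsClosed S = IsOpen τ (∁ S)

  IsDiscrete : Set (suc ℓ)
  IsDiscrete = (S : Pred X ℓ) → IsOpen τ S

  Hausdorff : Set (suc ℓ)
  Hausdorff = ∀ x y → x ≢ y →
    ∃[ S ] ∃[ T ] (IsOpen τ S × IsOpen τ T × x ∈ S × y ∈ T × Empty (S ∩ T))

  -- A local base of cardinality less than κ is given as an indexed family;
  -- a family indexed by a type of size less than κ has fewer than κ members,
  -- and every set of open sets of size less than κ arises in this way.
  record LocalBase< (κ : Set ℓ) (x : X) : Set (suc ℓ) where
    field
      Index    : Set ℓ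
      small    : Index ≺ κ
      base     : Index → Pred X ℓ
      isOpen   : ∀ i → IsOpen τ (base i)
      contains : ∀ i → x ∈ base i
      refines  : ∀ {O} → IsOpen τ O → x ∈ O → ∃[ i ] (base i ⊆ O)

  record ONA : Set (suc ℓ) where
    field
      nbhd     : X → Pred X ℓ
      isOpen   : ∀ x → IsOpen τ (nbhd x)
      contains : ∀ x → x ∈ nbhd x

open ONA public using (nbhd)

ClosedDiscrete : ∀ {ℓ} {X : Set ℓ} → Topology X → Pred X ℓ → Set (suc ℓ)
ClosedDiscrete τ D = IsClosed τ D × IsDiscrete (subspace τ D)

Locally< : ∀ {ℓ} {X : Set ℓ} → Set ℓ → Topology X → Set (suc ℓ)
Locally< κ τ = Σ[ U ∈ ONA τ ] (∀ x → ∣ nbhd U x ∣ ≺ κ)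

------------------------------------------------------------------------
-- σ-D spaces

module _ {ℓ} {X : Set ℓ} {τ : Topology X} where

  Finer : ONA τ → ONA τ → Set ℓ
  Finer V U = ∀ x → nbhd V x ⊆ nbhd U x

  -- ⋃ U``D
  cover : ONA τ → Pred X ℓ → Pred X ℓ
  cover U D y = ∃[ x ] (x ∈ D × y ∈ nbhd U x)

  Sticky : ONA τ → Pred X ℓ → Set (suc ℓ)
  Sticky U D = ClosedDiscrete τ D × (∀ x → nbhd U x ≬ D → x ∈ cover U D)

  ℙ : Set ℓ → ONA τ → Pred (Pred X ℓ) (suc ℓ)
  ℙ σ U D = Sticky U D × ∣ D ∣ ≺ σ

  Extends : ONA τ → Pred X ℓ → Pred X ℓ → Set ℓ
  Extends U D D′ = D ⊆ D′ × Empty ((D′ ∖ D) ∩ cover U D)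

  IsDWrt : Set ℓ → ONA τ → Set (suc ℓ)
  IsDWrt σ U = ∀ D → D ∈ ℙ σ U → ∀ x →
    ∃[ D′ ] (D′ ∈ ℙ σ U × Extends U D D′ × x ∈ cover U D′)

IsD : ∀ {ℓ} {X : Set ℓ} → Set ℓ → Topology X → Set (suc ℓ)
IsD σ τ = (U : ONA τ) → Σ[ V ∈ ONA τ ] (Finer V U × IsDWrt σ V)

{-# OPTIONS --safe #-}
module Submission where

-- Well-order X with initial segments of size < κ and let f : κ → X be least, modulo the ultrafilter,
-- among the functions that are not almost everywhere constant. Put Y α = {x | x < f α}. Every x lies
-- in Y α for a.e. α, and every function g with g α ∈ Y α a.e. is a.e. constant; hence properties that
-- hold a.e. for each x hold a.e. for all x ∈ Y α simultaneously. A.e. Y α is as required.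
--
-- If a.e. Y α were not σ-D, take an ONA U α of Y α witnessing this. As local bases have size < κ,
-- some basic set at x is a.e. below U α x; these sets form an ONA of X, which has a finer V for which
-- X is σ-D. A.e. the restriction of V to Y α refines U α, so it fails there at some sticky D α and
-- point x α. Both are a.e. constant (D α because |D α| < σ < κ), and the limit D is V-sticky in X.
-- Its extension D′ covering the limit point has size < κ, so it lies inside Y α a.e.: a contradiction.

open import Axiom.ExcludedMiddle using (ExcludedMiddle)
open import Axiom.Extensionality.Propositional using (Extensionality)
open import Data.Bool.Base using (Bool; true; false)
open import Data.Empty using (⊥; ⊥-elim)
import Data.Empty.Polymorphic as Polymorphic
open import Data.Irrelevant using ([_])
open import Data.Nat.Base using (ℕ; zero; suc)
open import Data.Product.Base using (Σ-syntax; ∃-syntax; _×_; _,_; proj₁; proj₂; swap)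
open import Data.Refinement as Refinement using (value; proof; value-injective; _,_)
open import Data.Sum.Base using (_⊎_; inj₁; inj₂; [_,_]′)
open import Data.Unit.Polymorphic.Base using (⊤; tt)
open import Function.Base using (_∘_; _on_; case_of_)
open import Function.Bundles using (_↔_; _↣_; mk↣; mk⇔; module Injection; module Inverse)
open import Function.Construct.Composition using (_↣-∘_)
open import Function.Properties.Inverse using (↔⇒↣; ↔-sym)
open import Induction.WellFounded using (Acc; acc; WellFounded)
open import Level using (Lift; lift; lower; _⊔_) renaming (suc to lsuc)
import Relation.Binary.Construct.On as On
open import Relation.Binary.Core using (Rel)
open import Relation.Binary.PropositionalEquality
  using (_≡_; _≢_; refl; sym; trans; cong; subst)
open import Relation.Nullary.Decidable
  using (does; does-⇔; dec-true; dec-false; yes; no; True; toWitness; fromWitness; recompute)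
open import Relation.Nullary.Negation using (¬_; contradiction)
open import Relation.Unary
  using (Pred; _∈_; _∉_; _⊆_; _≐_; ∁; _∩_; _∪_; ⋃; ｛_｝; _⊢_)
open import Defs

-- Embeddings and strict comparison of cardinals.

↣-≺-trans : ∀ {a b c} {A : Set a} {B : Set b} {C : Set c} → A ↣ B → B ≺ C → A ≺ C
↣-≺-trans f (g , ¬h) = g ↣-∘ f , λ h → ¬h (f ↣-∘ h)

≺-↣-trans : ∀ {a b c} {A : Set a} {B : Set b} {C : Set c} → A ≺ B → B ↣ C → A ≺ C
≺-↣-trans (f , ¬h) g = g ↣-∘ f , λ h → ¬h (h ↣-∘ g)

∣-∣-mono : ∀ {a p q} {A : Set a} {P : Pred A p} {Q : Pred A q} → P ⊆ Q → ∣ P ∣ ↣ ∣ Q ∣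
∣-∣-mono P⊆Q = mk↣ {to = Refinement.refine P⊆Q} (λ e → value-injective (cong value e))

value↣ : ∀ {a p} {A : Set a} {P : Pred A p} → ∣ P ∣ ↣ A
value↣ = mk↣ {to = value} value-injective

module Classical (em : ∀ {a} → ExcludedMiddle a) (ext : ∀ {a b} → Extensionality a b) where

  recover : ∀ {a p} {A : Set a} {P : Pred A p} (x : ∣ P ∣) → value x ∈ P
  recover (_ , [ p ]) = recompute em p

  em-yes : ∀ {p} {P : Set p} → P → ∃[ p ] em {P = P} ≡ yes p
  em-yes {P = P} p with em {P = P}
  ... | yes q = q , refl
  ... | no ¬p = contradiction p ¬p

  -- Zermelo's well-ordering theorem and orders with small initial segments.

  record WellOrder {ℓ} (A : Set ℓ) : Set (lsuc ℓ) where
    infix 4 _<_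
    field
      _<_         : Rel A ℓ
      wellFounded : WellFounded _<_
      connected   : ∀ {x y} → x ≢ y → x < y ⊎ y < x

  module Zermelo {ℓ} {A : Set ℓ} (a₀ : A) where

    choose : (A → Bool) → A
    choose s with em {P = ∃[ a ] s a ≡ false}
    ... | yes (a , _) = a
    ... | no _ = a₀

    choose-∉ : ∀ (s : A → Bool) {a} → s a ≡ false → s (choose s) ≡ false
    choose-∉ s q with em {P = ∃[ a ] s a ≡ false}
    ... | yes (_ , p) = p
    ... | no ¬p = contradiction (_ , q) ¬p

    -- Choosing from the characteristic function makes next respect _≐_.
    next : Pred A ℓ → A
    next S = choose (λ a → does (em {P = a ∈ S}))

    next-cong : ∀ {S T} → S ≐ T → next S ≡ next T
    next-cong (S⊆T , T⊆S) = cong choose (ext λ a → does-⇔ (mk⇔ S⊆T T⊆S) em em)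

    next-∉ : ∀ S {a} → a ∉ S → next S ∉ S
    next-∉ S a∉S p with () ← trans (sym (dec-true em p))
      (choose-∉ (λ a → does (em {P = a ∈ S})) (dec-false em a∉S))

    _⁺ : Pred A ℓ → Pred A ℓ
    S ⁺ = S ∪ ｛ next S ｝

    -- Codes for the stages of a transfinite iteration of `_⁺`: the empty family starts it, a
    -- one-member family takes a successor.
    data Tower : Set (lsuc ℓ) where
      sup : {I : Set ℓ} → (I → Tower) → Tower

    ⟦_⟧ : Tower → Pred A ℓ
    ⟦ sup {I} t ⟧ = ⋃ I (λ i → ⟦ t i ⟧ ⁺)

    _⊑_ : Tower → Tower → Set ℓ
    s ⊑ t = ⟦ s ⟧ ⊆ ⟦ t ⟧

    _⊏_ : Tower → Tower → Set ℓ
    s ⊏ t = ⟦ s ⟧ ⁺ ⊆ ⟦ t ⟧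

    Comparable : Tower → Tower → Set ℓ
    Comparable s t = (s ⊑ t ⊎ t ⊏ s) × (t ⊑ s ⊎ s ⊏ t)

    -- Unless `t ⊏ sup f`, no `f i` can equal `t` or lie strictly above it, so every `f i` lies
    -- strictly below `t`.
    compare-sup : ∀ {I} (f : I → Tower) t → (∀ i → Comparable (f i) t) →
                  sup f ⊑ t ⊎ t ⊏ sup f
    compare-sup f t ih with em {P = t ⊏ sup f}
    ... | yes t⊏f = inj₂ t⊏f
    ... | no t⊏̸f = inj₁ λ (i , p) → below i (ih i) p
      where
      below : ∀ i → Comparable (f i) t → f i ⊏ t
      below i (inj₂ t⊏fi , _) = ⊥-elim (t⊏̸f λ p → i , inj₁ (t⊏fi p))
      below i (inj₁ fi⊑t , inj₂ fi⊏t) = fi⊏t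
      below i (inj₁ fi⊑t , inj₁ t⊑fi) = ⊥-elim (t⊏̸f λ
        { (inj₁ p) → i , inj₁ (t⊑fi p)
        ; (inj₂ refl) → i , inj₂ (next-cong (fi⊑t , t⊑fi)) })

    compare : ∀ s t → Comparable s t
    compare (sup f) (sup g) =
      compare-sup f (sup g) (λ i → compare (f i) (sup g)) ,
      compare-sup g (sup f) (λ j → swap (compare (sup f) (g j)))

    Enters : A → Tower → Set ℓ
    Enters a t = a ∉ ⟦ t ⟧ × next ⟦ t ⟧ ≡ a

    enters : ∀ {a} t → a ∈ ⟦ t ⟧ → ∃[ s ] Enters a s
    enters (sup f) (i , inj₁ p) = enters (f i) p
    enters {a} (sup f) (i , inj₂ p) with em {P = a ∈ ⟦ f i ⟧}
    ... | yes q = enters (f i) q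
    ... | no q = f i , q , p

    -- Were `t ⊏ s`, the point `a` added right after `t` would already belong to `s`.
    enters-⊑ : ∀ {a s t} → Enters a s → Enters a t → s ⊑ t
    enters-⊑ {s = s} {t} (a∉s , _) (_ , next-t) with proj₁ (compare s t)
    ... | inj₁ s⊑t = s⊑t
    ... | inj₂ t⊏s = contradiction (t⊏s (inj₂ next-t)) a∉s

    -- Towers form a large type, so one tower is chosen for each reachable point; `True` keeps the
    -- index type at level `ℓ`.
    total : Tower
    total = sup {I = Σ[ a ∈ A ] True (em {P = ∃[ t ] a ∈ ⟦ t ⟧})}
      (λ (a , p) → proj₁ (toWitness p))

    ⊑-total : ∀ t → t ⊑ total
    ⊑-total t {a} p = (a , q) , inj₁ (proj₂ (toWitness q))
      where q = fromWitness (t , p)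

    -- A missing point would let `next` enlarge `total`, yet the enlarged stage is again below
    -- `total`.
    total-full : ∀ a → a ∈ ⟦ total ⟧
    total-full a with em {P = a ∈ ⟦ total ⟧}
    ... | yes p = p
    ... | no a∉ = contradiction
      (⊑-total (sup {I = ⊤} λ _ → total) (tt , inj₂ refl)) (next-∉ ⟦ total ⟧ a∉)

    seg : A → Tower
    seg a = proj₁ (enters total (total-full a))

    seg-enters : ∀ a → Enters a (seg a)
    seg-enters a = proj₂ (enters total (total-full a))

    _<_ : Rel A ℓ
    a < b = a ∈ ⟦ seg b ⟧

    -- Induction on the tower: if `a` is added right after `f i`, then `seg a ⊑ f i`, so all
    -- predecessors of `a` lie in the subtree `f i`.
    <-acc : ∀ {a} t → a ∈ ⟦ t ⟧ → Acc _<_ a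
    <-acc (sup f) (i , inj₁ p) = <-acc (f i) p
    <-acc {a} (sup f) (i , inj₂ p) with em {P = a ∈ ⟦ f i ⟧}
    ... | yes q = <-acc (f i) q
    ... | no q = acc λ b<a → <-acc (f i)
      (enters-⊑ {s = seg a} {f i} (seg-enters a) (q , p) b<a)

    <-connected : ∀ {a b} → a ≢ b → a < b ⊎ b < a
    <-connected {a} {b} a≢b with compare (seg a) (seg b) | seg-enters a | seg-enters b
    ... | inj₂ b⊏a , _        | _         | _ , nextb = inj₂ (b⊏a (inj₂ nextb))
    ... | inj₁ _   , inj₂ a⊏b | _ , nexta | _         = inj₁ (a⊏b (inj₂ nexta))
    ... | inj₁ a⊑b , inj₁ b⊑a | _ , nexta | _ , nextb =
      contradiction (trans (sym nexta) (trans (next-cong (a⊑b , b⊑a)) nextb)) a≢b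

    wellOrder : WellOrder A
    wellOrder = record
      { _<_ = _<_ ; wellFounded = λ a → <-acc total (total-full a) ; connected = <-connected }

  minimal : ∀ {a r p} {A : Set a} {_<_ : Rel A r} → WellFounded _<_ → (P : Pred A p) →
            ∀ {x} → x ∈ P → ∃[ m ] (m ∈ P × (∀ {y} → y < m → y ∉ P))
  minimal {_<_ = _<_} wf P {x} = go (wf x)
    where
    go : ∀ {x} → Acc _<_ x → x ∈ P → ∃[ m ] (m ∈ P × (∀ {y} → y < m → y ∉ P))
    go {x} (acc rs) p with em {P = ∃[ y ] (y < x × y ∈ P)}
    ... | yes (y , y<x , q) = go (rs y<x) q
    ... | no ¬q = x , p , λ y<x q → ¬q (_ , y<x , q)

  InitialSegments≺ : ∀ {ℓ} {A : Set ℓ} → WellOrder A → Set ℓ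
  InitialSegments≺ {A = A} w = ∀ x → ∣ (_< x) ∣ ≺ A
    where open WellOrder w

  abstract
    initialWellOrder : ∀ {ℓ} {A : Set ℓ} → A → Σ[ w ∈ WellOrder A ] InitialSegments≺ w
    initialWellOrder {A = A} a₀
      with em {P = ∃[ x ] (A ↣ ∣ (λ y → WellOrder._<_ (Zermelo.wellOrder a₀) y x) ∣)}
    ... | no ¬e = Zermelo.wellOrder a₀ , λ x → value↣ , λ e → ¬e (x , e)
    ... | yes (_ , e) =
      -- The least initial segment into which A still embeds has small initial segments.
      case minimal wellFounded (λ x → A ↣ ∣ (_< x) ∣) e of λ (x , h , least) →
      pullback h , λ y → value↣ ,
      λ k → least (recover (Injection.to h y)) (segment h y ↣-∘ k)
      where
      open WellOrder (Zermelo.wellOrder a₀)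
      module _ {x} (h : A ↣ ∣ (_< x) ∣) where
        g : A → A
        g = value ∘ Injection.to h
        g-injective : ∀ {y z} → g y ≡ g z → y ≡ z
        g-injective eq = Injection.injective h (value-injective eq)
        pullback : WellOrder A
        pullback = record
          { _<_         = _<_ on g
          ; wellFounded = On.wellFounded g wellFounded
          ; connected   = λ y≢z → connected (y≢z ∘ g-injective)
          }
        segment : ∀ y → ∣ (λ z → g z < g y) ∣ ↣ ∣ (_< g y) ∣
        segment y = mk↣ {to = Refinement.map g (λ p → p)}
          (λ eq → value-injective (g-injective (cong value eq)))

  -- Quantification almost everywhere modulo the ultrafilter.

  module AlmostEverywhere {ℓ} {κ : Set ℓ} (measurable : Measurable κ) where

    open Measurable measurable
    open IsUltrafilter isUltrafilter

    -- `𝒰` only contains predicates at level `ℓ`; asking for a subset in `𝒰` extends the notion to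
    -- every level.
    Ae : ∀ {p} → Pred κ p → Set (lsuc ℓ ⊔ p)
    Ae P = ∃[ S ] (S ∈ 𝒰 × S ⊆ P)

    ae-map : ∀ {p q} {P : Pred κ p} {Q : Pred κ q} → P ⊆ Q → Ae P → Ae Q
    ae-map P⊆Q (S , u , S⊆P) = S , u , λ s → P⊆Q (S⊆P s)

    ae-∩ : ∀ {p q} {P : Pred κ p} {Q : Pred κ q} → Ae P → Ae Q → Ae (P ∩ Q)
    ae-∩ (S , u , S⊆P) (T , v , T⊆Q) = S ∩ T , meet u v , λ (s , t) → S⊆P s , T⊆Q t

    ae-all : ∀ {p} {P : Pred κ p} → (∀ α → α ∈ P) → Ae P
    ae-all p = _ , whole , λ _ → p _

    ae-em : ∀ {p} (P : Pred κ p) → Ae P ⊎ Ae (∁ P)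
    ae-em P with ultra (λ α → Lift ℓ (True (em {P = α ∈ P})))
    ... | inj₁ u = inj₁ (_ , u , toWitness ∘ lower)
    ... | inj₂ u = inj₂ (_ , u , λ ¬p p → ¬p (lift (fromWitness p)))

    ae-witness : ∀ {p} {P : Pred κ p} → Ae P → ∃[ α ] α ∈ P
    ae-witness (S , u , S⊆P) with em {P = ∃[ α ] α ∈ S}
    ... | yes (α , s) = α , S⊆P s
    ... | no ¬s = ⊥-elim (proper (upward (λ s → ⊥-elim (¬s (_ , s))) u))

    ae-contradiction : ∀ {p w} {P : Pred κ p} {W : Set w} → Ae P → Ae (∁ P) → W
    ae-contradiction p ¬p = case ae-witness (ae-∩ p ¬p) of λ (_ , q , ¬q) → contradiction q ¬q

    ae-∀ : ∀ {p} {I : Set ℓ} {P : I → Pred κ p} → I ≺ κ → (∀ i → Ae (P i)) →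
           Ae (λ α → ∀ i → α ∈ P i)
    ae-∀ I≺κ ae =
      _ , complete I≺κ (proj₁ ∘ ae) (proj₁ ∘ proj₂ ∘ ae) , λ s i → proj₂ (proj₂ (ae i)) (s i)

    -- If each `P i` failed almost everywhere, completeness would make all of them fail together.
    ae-∃ : ∀ {p} {I : Set ℓ} {P : I → Pred κ p} → I ≺ κ →
           Ae (λ α → ∃[ i ] α ∈ P i) → ∃[ i ] Ae (P i)
    ae-∃ {P = P} I≺κ ae with em {P = ∃[ i ] Ae (P i)}
    ... | yes e = e
    ... | no ¬e = ae-contradiction ae (ae-map (λ ¬p (i , p) → ¬p i p) (ae-∀ I≺κ λ i →
      [ (λ p → contradiction (i , p) ¬e) , (λ ¬p → ¬p) ]′ (ae-em (P i))))

    -- A set in `𝒰` inside the singleton of `β` would make `𝒰` principal.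
    ae-≢ : ∀ β → ¬ Ae (_≡ β)
    ae-≢ β (T , v , T⊆β) = nonprincipal
      (β , λ S → mk⇔ (to S) λ b → upward (λ t → subst S (sym (T⊆β t)) b) v)
      where
      to : ∀ S → S ∈ 𝒰 → β ∈ S
      to S u = case ae-witness (T ∩ S , meet v u , λ t → t) of
        λ (α , t , s) → subst S (T⊆β t) s

    ae-choice : ∀ {b c} {B : κ → Set b} (C : ∀ α → Pred (B α) c) → (∀ α → B α) →
                Ae (λ α → ∃[ b ] b ∈ C α) → ∃[ f ] Ae (λ α → f α ∈ C α)
    ae-choice {B = B} C default = λ ae → f , ae-map f-C ae
      where
      f : ∀ α → B α
      f α with em {P = ∃[ b ] b ∈ C α}
      ... | yes (b , _) = b
      ... | no _ = default α
      f-C : ∀ {α} → ∃[ b ] b ∈ C α → f α ∈ C α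
      f-C {α} e with em {P = ∃[ b ] b ∈ C α}
      ... | yes (_ , c) = c
      ... | no ¬e = contradiction e ¬e

    -- The least non-constant function and normality.

    module Normal {X : Set ℓ} (X↔κ : X ↔ κ) where

      open Inverse X↔κ using (to; from; strictlyInverseˡ)

      private
        x₀ : X
        x₀ = from (Injection.to (proj₁ uncountable) 0)

        w = initialWellOrder x₀
        open WellOrder (proj₁ w)

      NonConstant : (κ → X) → Set (lsuc ℓ)
      NonConstant f = ∀ x → ¬ Ae (λ α → f α ≡ x)

      from-nonConstant : NonConstant from
      from-nonConstant x ae =
        ae-≢ (to x) (ae-map (λ {α} eq → trans (sym (strictlyInverseˡ α)) (cong to eq)) ae)

      ℕ≺κ : Lift ℓ ℕ ≺ κ
      ℕ≺κ = ↣-≺-trans (mk↣ {to = lower} (λ { refl → refl })) uncountable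

      Least : Pred (κ → X) (lsuc ℓ)
      Least f = NonConstant f × (∀ g → Ae (λ α → g α < f α) → ¬ NonConstant g)

      abstract
        -- Countable completeness makes the ultrapower of a well-order well-founded.
        leastNonConstant : ∃[ f ] f ∈ Least
        leastNonConstant with em {P = ∃[ f ] f ∈ Least}
        ... | yes e = e
        ... | no ¬e =
          case ae-witness (ae-∀ ℕ≺κ (λ (lift n) → proj₂ (proj₂ (step (seq n))))) of
          λ (α , descending) →
          case minimal wellFounded (λ x → ∃[ n ] proj₁ (seq n) α ≡ x) (0 , refl) of λ where
            (_ , (n , refl) , least) → ⊥-elim (least (descending (lift n)) (suc n , refl))
          where
          step : (f : ∃[ f ] NonConstant f) → ∃[ g ] (NonConstant g × Ae (λ α → g α < proj₁ f α))
          step (f , nc) with em {P = ∃[ g ] (NonConstant g × Ae (λ α → g α < f α))}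
          ... | yes d = d
          ... | no ¬d = contradiction (f , nc , λ g g<f ncg → ¬d (g , ncg , g<f)) ¬e
          seq : ℕ → ∃[ f ] NonConstant f
          seq zero = from , from-nonConstant
          seq (suc n) = proj₁ (step (seq n)) , proj₁ (proj₂ (step (seq n)))

      private
        f = proj₁ leastNonConstant
        f-nonConstant = proj₁ (proj₂ leastNonConstant)
        f-least = proj₂ (proj₂ leastNonConstant)

      -- In the ultrapower by 𝒰, Y represents the set of standard points of X (fine, press).
      Y : κ → Pred X ℓ
      Y α x = x < f α

      Y-small : ∀ α → ∣ Y α ∣ ≺ κ
      Y-small α = ≺-↣-trans (proj₂ w (f α)) (↔⇒↣ X↔κ)

      -- Otherwise `f α < x` almost everywhere; as fewer than `κ` points precede `x`, completeness
      -- would make `f` constant almost everywhere.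
      fine : ∀ x → Ae (λ α → x ∈ Y α)
      fine x with ae-em (λ α → x < f α) | ae-em (λ α → f α ≡ x)
      ... | inj₁ x<f | _ = x<f
      ... | inj₂ _ | inj₁ f≡x = contradiction f≡x (f-nonConstant x)
      ... | inj₂ x≮f | inj₂ f≢x =
        case ae-∃ {P = λ (y , _) α → f α ≡ y} (≺-↣-trans (proj₂ w x) (↔⇒↣ X↔κ))
          (ae-map (λ (x≮f , f≢x) → below x≮f (connected f≢x)) (ae-∩ x≮f f≢x))
        of λ (y , f≡y) → contradiction f≡y (f-nonConstant (value y))
        where
        below : ∀ {α} → ¬ (x < f α) → f α < x ⊎ x < f α → ∃[ y ] (f α ≡ value {P = _< x} y)
        below x≮f (inj₁ f<x) = (_ , [ f<x ]) , refl
        below x≮f (inj₂ x<f) = contradiction x<f x≮f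

      -- A pressing-down argument: a choice function `g` is almost everywhere below `f`, hence
      -- almost everywhere constant by minimality.
      press : ∀ {r} {R : X → Pred κ r} →
              Ae (λ α → ∃[ x ] (x ∈ Y α × α ∈ R x)) → ∃[ x ] Ae (R x)
      press {R = R} ae with ae-choice (λ α x → x ∈ Y α × α ∈ R x) (λ _ → x₀) ae
      ... | g , aeg with em {P = ∃[ x ] Ae (λ α → g α ≡ x)}
      ... | yes (x , g≡x) = x , ae-map (λ { ((_ , r) , refl) → r }) (ae-∩ aeg g≡x)
      ... | no ¬c =
        contradiction (λ x g≡x → ¬c (x , g≡x)) (f-least g (ae-map proj₁ aeg))

      -- Counterexamples in `Y α` could be pressed to one `x` at which `P x` fails almost
      -- everywhere.
      diagonal : ∀ {p} {P : X → Pred κ p} → (∀ x → Ae (P x)) →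
                 Ae (λ α → ∀ {x} → x ∈ Y α → α ∈ P x)
      diagonal {P = P} ae with ae-em (λ α → ∀ {x} → x ∈ Y α → α ∈ P x)
      ... | inj₁ d = d
      ... | inj₂ ¬d = case press (ae-map counterexample ¬d) of λ (x , ¬p) → ae-contradiction (ae x) ¬p
        where
        counterexample : ∀ {α} → ¬ (∀ {x} → x ∈ Y α → α ∈ P x) → ∃[ x ] (x ∈ Y α × α ∉ P x)
        counterexample {α} ¬h with em {P = ∃[ x ] (x ∈ Y α × α ∉ P x)}
        ... | yes e = e
        ... | no ¬e = contradiction (λ {x} y → case em {P = α ∈ P x} of λ where
          (yes p) → p
          (no ¬p) → contradiction (x , y , ¬p) ¬e) ¬h

      fine-⊆ : {D : Pred X ℓ} → ∣ D ∣ ≺ κ → Ae (λ α → D ⊆ Y α)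
      fine-⊆ D≺κ = ae-map (λ h {x} d → h (x , [ d ])) (ae-∀ D≺κ (λ d → fine (value d)))

      -- By completeness over `θ`, the image of `e a` under the embedding of `E α` is almost
      -- everywhere one fixed element of `θ`; points sharing it are separated at no common `α`.
      limit-↣ : {A θ : Set ℓ} {E : κ → Pred X ℓ} → θ ≺ κ → (e : A ↣ X) →
                (∀ a → Ae (λ α → Injection.to e a ∈ E α)) → Ae (λ α → ∣ E α ∣ ↣ θ) → A ↣ θ
      limit-↣ {A} {θ} {E} θ≺κ e a∈E E↣θ = mk↣ {to = proj₁ ∘ limit} injective
        where
        Value : A → θ → Pred κ ℓ
        Value a t α = Σ[ p ∈ Injection.to e a ∈ E α ] Σ[ h ∈ ∣ E α ∣ ↣ θ ]
          -- Taking the `h` returned by `em` makes it depend on `α` alone, so that `a` and `b` are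
          -- compared under the same injection.
          (em {P = ∣ E α ∣ ↣ θ} ≡ yes h × Injection.to h (_ , [ p ]) ≡ t)
        value-at : ∀ {a α} → Injection.to e a ∈ E α → ∣ E α ∣ ↣ θ → ∃[ t ] α ∈ Value a t
        value-at p h = case em-yes h of λ (h′ , eq) → _ , p , h′ , eq , refl
        limit : ∀ a → ∃[ t ] Ae (Value a t)
        limit a =
          ae-∃ θ≺κ (ae-map (λ (p , h) → value-at p h) (ae-∩ (a∈E a) E↣θ))
        injective : ∀ {a b} → proj₁ (limit a) ≡ proj₁ (limit b) → a ≡ b
        injective {a} {b} eq with ae-witness (ae-∩ (proj₂ (limit a)) (proj₂ (limit b)))
        ... | _ , (_ , h , em≡h , h≡) , (_ , k , em≡k , k≡) with trans (sym em≡h) em≡k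
        ... | refl = Injection.injective e
          (cong value (Injection.injective h (trans h≡ (trans eq (sym k≡)))))

      -- Let `L` collect the points almost always in `E α`. By `diagonal`, `L` and `E α` agree on
      -- `Y α`, and `L` is small enough to lie inside `Y α`.
      limitSet : {θ : Set ℓ} (E : κ → Pred X ℓ) → θ ≺ κ →
                 Ae (λ α → E α ⊆ Y α) → Ae (λ α → ∣ E α ∣ ↣ θ) →
                 ∃[ L ] Ae (λ α → L ≐ E α)
      limitSet {θ} E θ≺κ E⊆Y E↣θ = L , ae-map
        (λ (E⊆Y , L⊆Y , h) → (λ l → proj₁ (h (L⊆Y l)) l) , (λ e → proj₂ (h (E⊆Y e)) e))
        (ae-∩ E⊆Y (ae-∩ (fine-⊆ (↣-≺-trans L↣θ θ≺κ)) (diagonal agree)))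
        where
        L : Pred X ℓ
        L x = Lift ℓ (True (em {P = Ae (λ α → x ∈ E α)}))
        L↣θ : ∣ L ∣ ↣ θ
        L↣θ = limit-↣ θ≺κ value↣ (λ l → toWitness (lower (recover l))) E↣θ
        agree : ∀ x → Ae (λ α → (x ∈ L → x ∈ E α) × (x ∈ E α → x ∈ L))
        agree x with ae-em (λ α → x ∈ E α)
        ... | inj₁ e = ae-map (λ p → (λ _ → p) , λ _ → lift (fromWitness e)) e
        ... | inj₂ ¬e = ae-map
          (λ ¬p → (λ l → ae-contradiction (toWitness (lower l)) ¬e) , λ p → contradiction p ¬p) ¬e

  -- Transfer between a space and its subspaces.

  module _ {ℓ} {X : Set ℓ} where

    image : {Y : Pred X ℓ} → Pred ∣ Y ∣ ℓ → Pred X ℓ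
    image {Y} S x = Σ[ y ∈ x ∈ Y ] (x , [ y ]) ∈ S

    image-↣ : {Y : Pred X ℓ} {S : Pred ∣ Y ∣ ℓ} → ∣ image S ∣ ↣ ∣ S ∣
    image-↣ {Y} {S} = mk↣ {to = λ d → (value d , [ proj₁ (recover d) ]) , [ proj₂ (recover d) ]}
      (λ eq → value-injective (cong (value ∘ value) eq))

  module _ {ℓ} {X : Set ℓ} (τ : Topology X) where

    open Topology τ using (resp-≐; union) renaming (meet to ∩-open; whole to whole-open)

    locallyOpen⇒open : ∀ {S} → (∀ {x} → x ∈ S → ∃[ O ] (IsOpen τ O × x ∈ O × O ⊆ S)) → IsOpen τ S
    locallyOpen⇒open {S} nhd = resp-≐
      ((λ ((_ , s) , o) → proj₂ (proj₂ (proj₂ (nhd s))) o) ,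
       (λ s → (_ , s) , proj₁ (proj₂ (proj₂ (nhd s)))))
      (union {I = ∃[ x ] x ∈ S} (λ (_ , s) → proj₁ (nhd s)) (λ (_ , s) → proj₁ (proj₂ (nhd s))))

    wholeONA : ONA τ
    wholeONA = record { nbhd = λ _ _ → ⊤ ; isOpen = λ _ → whole-open ; contains = λ _ → tt }

    image-open : ∀ {Y} S → IsOpen τ Y → IsOpen (subspace τ Y) S → IsOpen τ (image S)
    image-open S Y-open (O , O-open , S⊆O , O⊆S) =
      resp-≐ ((λ (y , o) → y , O⊆S o) , (λ (y , s) → y , S⊆O s)) (∩-open Y-open O-open)

    -- A subset of `D` is matched with the subset of `E` having the same underlying points; the open
    -- set of `X` cutting out one cuts out the other.
    image-discrete : ∀ {Y} (E : Pred ∣ Y ∣ ℓ) {D} → D ≐ image E →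
                     IsDiscrete (subspace (subspace τ Y) E) → IsDiscrete (subspace τ D)
    image-discrete E {D} (D⊆E , _) discrete S =
      case discrete (λ e → ∃[ d ] (d ∈ S × value d ≡ value (value e))) of
      λ (O , (O′ , O′-open , O⊆O′ , O′⊆O) , S⊆O , O⊆S) →
      O′ , O′-open ,
      (λ {d} s → O⊆O′ (S⊆O {lift-point d} (d , s , refl))) ,
      (λ {d} o → case O⊆S {lift-point d} (O′⊆O o) of λ (_ , s , eq) →
        subst S (value-injective eq) s)
      where
      lift-point : ∣ D ∣ → ∣ E ∣
      lift-point d = (value d , [ proj₁ (D⊆E (recover d)) ]) , [ proj₂ (D⊆E (recover d)) ]

  module _ {ℓ} {X : Set ℓ} {τ : Topology X} where

    trace-discrete : ∀ {Y D} → IsDiscrete (subspace τ D) →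
                     IsDiscrete (subspace (subspace τ Y) (value ⊢ D))
    trace-discrete discrete S =
      case discrete (λ d → ∃[ e ] (e ∈ S × value (value e) ≡ value d)) of
      λ (O , O-open , S⊆O , O⊆S) →
      value ⊢ O , (O , O-open , (λ o → o) , (λ o → o)) ,
      (λ {e} s → S⊆O {value (value e) , proof e} (e , s , refl)) ,
      (λ {e} o → case O⊆S {value (value e) , proof e} o of λ (_ , s , eq) →
        subst S (value-injective (value-injective eq)) s)

    restrict : ONA τ → (Y : Pred X ℓ) → ONA (subspace τ Y)
    restrict V Y = record
      { nbhd     = λ y → value ⊢ nbhd V (value y)
      ; isOpen   = λ y → nbhd V (value y) , ONA.isOpen V (value y) , (λ v → v) , (λ v → v)
      ; contains = λ y → ONA.contains V (value y)
      }

    cover-trace : ∀ (V : ONA τ) {Y} (D : Pred X ℓ) → D ⊆ Y →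
                  ∀ {y} → value y ∈ cover V D → y ∈ cover (restrict V Y) (value ⊢ D)
    cover-trace V D D⊆Y (d , d∈D , y∈Vd) = (d , [ D⊆Y d∈D ]) , d∈D , y∈Vd

    -- Stickiness survives because `D ⊆ Y` keeps the covering points in the subspace.
    ℙ-trace : ∀ {σ : Set ℓ} (V : ONA τ) {Y D} → D ⊆ Y →
              D ∈ ℙ σ V → (value ⊢ D) ∈ ℙ σ (restrict V Y)
    ℙ-trace V {D = D} D⊆Y (((closed , discrete) , sticky) , D≺σ) =
      (((∁ D , closed , (λ ¬d → ¬d) , (λ ¬d → ¬d)) , trace-discrete discrete) ,
       λ x (y , y∈Vx , y∈D) →
         cover-trace V D D⊆Y {x} (sticky (value x) (value y , y∈Vx , y∈D))) ,
      ↣-≺-trans (mk↣ {to = λ e → value (value e) , proof e}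
        (λ eq → value-injective (value-injective (cong value eq)))) D≺σ

  -- Reflection of openness, size and the `σ`-D property to `Y α`.

  module Reflection {ℓ} {κ : Set ℓ} (measurable : Measurable κ) {X : Set ℓ} (X↔κ : X ↔ κ)
                    {τ : Topology X} {σ : Set ℓ} (σ≺κ : σ ≺ κ) where

    open AlmostEverywhere measurable
    open Normal X↔κ

    -- Each `nbhd N x` is small, so it lies in `Y α` almost everywhere; `diagonal` gives this for
    -- all `x ∈ Y α` at once.
    Y-open : Locally< κ τ → Ae (λ α → IsOpen τ (Y α))
    Y-open (N , N≺κ) = ae-map
      (λ N⊆Y → locallyOpen⇒open τ λ {x} y →
        nbhd N x , ONA.isOpen N x , ONA.contains N x , N⊆Y y)
      (diagonal {P = λ x α → nbhd N x ⊆ Y α} (λ x → fine-⊆ (N≺κ x)))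

    -- If `Y α` embedded into `θ` almost everywhere, `limit-↣` would embed `κ` into `θ`.
    Y-large : {θ : Set ℓ} → θ ≺ κ → Ae (λ α → θ ≺ ∣ Y α ∣)
    Y-large {θ} θ≺κ = ae-∩ embeds not-embedded
      where
      e : θ ↣ X
      e = ↔⇒↣ (↔-sym X↔κ) ↣-∘ proj₁ θ≺κ
      embeds : Ae (λ α → θ ↣ ∣ Y α ∣)
      embeds = ae-map
        (λ h → mk↣ {to = λ t → Injection.to e t , [ h t ]}
          (λ eq → Injection.injective e (cong value eq)))
        (ae-∀ θ≺κ (λ t → fine (Injection.to e t)))
      not-embedded : Ae (λ α → ¬ (∣ Y α ∣ ↣ θ))
      not-embedded with ae-em (λ α → ∣ Y α ∣ ↣ θ)
      ... | inj₁ h =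
        contradiction (limit-↣ θ≺κ (↔⇒↣ (↔-sym X↔κ)) (λ β → fine _) h) (proj₂ θ≺κ)
      ... | inj₂ ¬h = ¬h

    module _ (open-ae : Ae (λ α → IsOpen τ (Y α))) where

      isDWrt-reflects : (V : ONA τ) → IsDWrt σ V → Ae (λ α → IsDWrt σ (restrict V (Y α)))
      isDWrt-reflects V V-isD with ae-em (λ α → IsDWrt σ (restrict V (Y α)))
      ... | inj₁ isD = isD
      ... | inj₂ ¬isD = ⊥-elim absurd
        where
        Bad : X → ∀ α → Pred (Pred ∣ Y α ∣ ℓ) (lsuc ℓ)
        Bad x α D = D ∈ ℙ σ (restrict V (Y α)) × Σ[ y ∈ x ∈ Y α ]
          ¬ (∃[ D′ ] (D′ ∈ ℙ σ (restrict V (Y α)) × Extends (restrict V (Y α)) D D′ ×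
                      (x , [ y ]) ∈ cover (restrict V (Y α)) D′))

        bad-exists : ∀ {α} → ¬ IsDWrt σ (restrict V (Y α)) → ∃[ x ] (x ∈ Y α × ∃[ D ] Bad x α D)
        bad-exists {α} ¬isD with em {P = ∃[ x ] (x ∈ Y α × ∃[ D ] Bad x α D)}
        ... | yes b = b
        ... | no ¬b = contradiction (λ D d x → case em of λ where
          (yes e) → e
          (no ¬e) → contradiction (value x , recover x , D , d , recover x , ¬e) ¬b) ¬isD

        pressed : ∃[ x ] Ae (λ α → ∃[ D ] Bad x α D)
        pressed = press (ae-map bad-exists ¬isD)

        x = proj₁ pressed

        chosen : ∃[ D ] Ae (λ α → Bad x α (D α))
        -- The empty set is the default where no bad set exists.
        chosen = ae-choice (Bad x) (λ _ _ → Polymorphic.⊥) (proj₂ pressed)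

        D = proj₁ chosen

        limit : ∃[ L ] Ae (λ α → L ≐ image (D α))
        limit = limitSet (λ α → image (D α)) σ≺κ
          (ae-all {P = λ α → image (D α) ⊆ Y α} λ α → proj₁)
          (ae-map (λ ((_ , D≺σ) , _) → proj₁ D≺σ ↣-∘ image-↣) (proj₂ chosen))

        L = proj₁ limit

        Good : Pred κ (lsuc ℓ)
        Good α = IsOpen τ (Y α) × Bad x α (D α) × L ≐ image (D α)

        good : Ae Good
        good = ae-∩ open-ae (ae-∩ (proj₂ chosen) (proj₂ limit))

        -- A point outside `L` lies in some good `Y α`; there the complement of `D α` is relatively
        -- open, hence open in `X`.
        L-closed : IsClosed τ L
        L-closed = locallyOpen⇒open τ λ {z} z∉L → case ae-witness (ae-∩ good (fine z)) of
          λ (α , (Yα-open , ((((D-closed , _) , _) , _) , _) , L⊆D , D⊆L) , z∈Y) →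
          image (∁ (D α)) , image-open τ (∁ (D α)) Yα-open D-closed ,
          (z∈Y , λ d → z∉L (D⊆L (z∈Y , d))) , λ (_ , ¬d) l → ¬d (proj₂ (L⊆D l))

        -- Discreteness is read off at any good `α`, stickiness at `z` from a good `α` with
        -- `z ∈ Y α`.
        L-sticky : Sticky V L
        L-sticky =
          (L-closed ,
           (case ae-witness good of λ (α , _ , ((((_ , discrete) , _) , _) , _) , L≐D) →
            image-discrete τ (D α) L≐D discrete)) ,
          λ z (t , t∈Vz , t∈L) → case ae-witness (ae-∩ good (fine z)) of
          λ (α , (_ , (((_ , sticky) , _) , _) , L⊆D , D⊆L) , z∈Y) →
          case sticky (z , [ z∈Y ]) (_ , t∈Vz , proj₂ (L⊆D t∈L)) of
          λ (d , d∈D , z∈Vd) → value d , D⊆L (recover d , d∈D) , z∈Vd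

        L-small : ∣ L ∣ ≺ σ
        L-small = case ae-witness good of λ (α , _ , ((_ , D≺σ) , _) , L⊆D , _) →
          ↣-≺-trans (image-↣ ↣-∘ ∣-∣-mono L⊆D) D≺σ

        absurd : ⊥
        absurd = case V-isD L (L-sticky , L-small) x of
          λ (D′ , D′∈ℙ , (L⊆D′ , new) , x∈cover) →
          -- Since `D′` has size below `σ`, it fits inside a good `Y α`, where its trace is the
          -- extension that `Bad` forbids.
          case ae-witness (ae-∩ good (fine-⊆ (≺-↣-trans (proj₂ D′∈ℙ) (proj₁ σ≺κ)))) of
          λ (α , (_ , (_ , y , ¬extension) , L⊆D , D⊆L) , D′⊆Y) →
          ¬extension (value ⊢ D′ , ℙ-trace V D′⊆Y D′∈ℙ ,
            ((λ {d} d∈D → L⊆D′ (D⊆L (recover d , d∈D))) ,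
             (λ z ((z∈D′ , z∉D) , (d , d∈D , z∈Vd)) → new (value z)
               ((z∈D′ , λ l → z∉D (proj₂ (L⊆D l))) , value d , D⊆L (recover d , d∈D) , z∈Vd))) ,
            cover-trace V D′ D′⊆Y {x , [ y ]} x∈cover)

      isD-reflects : (∀ x → LocalBase< τ κ x) → IsD σ τ → Ae (λ α → IsD σ (subspace τ (Y α)))
      isD-reflects bases isD with ae-em (λ α → IsD σ (subspace τ (Y α)))
      ... | inj₁ isD-ae = isD-ae
      ... | inj₂ ¬isD = ⊥-elim absurd
        where
        open LocalBase<

        Bad : ∀ α → Pred (ONA (subspace τ (Y α))) (lsuc ℓ)
        Bad α U = ∀ V → Finer V U → ¬ IsDWrt σ V

        bad-exists : ∀ {α} → ¬ IsD σ (subspace τ (Y α)) → ∃[ U ] Bad α U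
        bad-exists {α} ¬isD with em {P = ∃[ U ] Bad α U}
        ... | yes b = b
        ... | no ¬b = contradiction (λ U → case em of λ where
          (yes e) → e
          (no ¬e) → contradiction (U , λ V V⊆U V-isD → ¬e (V , V⊆U , V-isD)) ¬b) ¬isD

        chosen : ∃[ U ] Ae (λ α → Bad α (U α))
        chosen = ae-choice Bad (λ α → wholeONA (subspace τ (Y α))) (ae-map bad-exists ¬isD)

        U = proj₁ chosen

        Below : Pred X ℓ → X → Pred κ ℓ
        Below S x α = Σ[ y ∈ x ∈ Y α ] (S ⊆ image (nbhd (U α) (x , [ y ])))

        -- Almost everywhere some basic set fits inside the neighbourhood given by `U α`; with fewer
        -- than `κ` indices, one index serves almost everywhere.
        limit : ∀ x → ∃[ i ] Ae (Below (base (bases x) i) x)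
        limit x = ae-∃ (small (bases x)) (ae-map (λ (Yα-open , y) →
          case refines (bases x)
            (image-open τ (nbhd (U _) (x , [ y ])) Yα-open (ONA.isOpen (U _) (x , [ y ])))
            (y , ONA.contains (U _) (x , [ y ]))
          of λ (i , below) → i , y , below) (ae-∩ open-ae (fine x)))

        U-limit : ONA τ
        U-limit = record
          { nbhd     = λ x → base (bases x) (proj₁ (limit x))
          ; isOpen   = λ x → isOpen (bases x) (proj₁ (limit x))
          ; contains = λ x → contains (bases x) (proj₁ (limit x))
          }

        absurd : ⊥
        absurd = case isD U-limit of λ (V , V⊆U , V-isD) →
          case ae-witness (ae-∩ (proj₂ chosen)
            -- `diagonal` puts `U-limit` below `U α` at all points of `Y α` simultaneously, so the
            -- restriction of `V` is finer than `U α`.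
            (ae-∩ (diagonal (λ x → proj₂ (limit x))) (isDWrt-reflects V V-isD))) of
          λ (α , bad , below , Vα-isD) →
          bad (restrict V (Y α))
            (λ y v → proj₂ (proj₂ (below (recover y)) (V⊆U (value y) v))) Vα-isD

theorem3p4 : (∀ {a} → ExcludedMiddle a) →
    (∀ {a b} → Extensionality a b) →
    ∀ {ℓ} (κ : Set ℓ) → Measurable κ →
    (X : Set ℓ) (τ : Topology X) →
    Locally< κ τ →
    Hausdorff τ →
    X ↔ κ →
    (∀ x → LocalBase< τ κ x) →
    (σ : Set ℓ) → Regular σ → Uncountable σ → σ ≺ κ →
    IsD σ τ →
    (θ : Set ℓ) → θ ≺ κ →
    ∃[ Y ] (IsOpen τ Y × IsD σ (subspace τ Y) × θ ≺ ∣ Y ∣ × ∣ Y ∣ ≺ κ)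
theorem3p4 em ext κ measurable X τ locally _ X↔κ bases σ _ _ σ≺κ isD θ θ≺κ =
  case ae-witness
    (ae-∩ Y-open-ae (ae-∩ (isD-reflects Y-open-ae bases isD) (Y-large θ≺κ))) of
  λ (α , Yα-open , Yα-isD , θ≺Y) → Y α , Yα-open , Yα-isD , θ≺Y , Y-small α
  where
  open Classical em ext
  open AlmostEverywhere measurable
  open Normal X↔κ
  open Reflection measurable X↔κ {τ} {σ} σ≺κ
  Y-open-ae = Y-open locally
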